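{- Let $\Gamma$ be a countable group, and fix a generic sequence $\langle(\gamma_n,s_n):n\in\omega\rangle$ with its associated graph $G_\Gamma$ and action $a_\Gamma$ on $\Gamma\times 2^\omega$. For any Borel graph $G$ on $\mathcal{N}$ and any Borel action $a$ of $\Gamma$ on $\mathcal{N}$, either $(G,a)$ admits a Borel $a$-coloring or there is an equivariant homomorphism from $G_\Gamma$ to $G$, i.e. a map $f:\Gamma\times 2^\omega\to\mathcal{N}$ such that (1) $f(h\cdot_{a_\Gamma}x)=h\cdot_a f(x)$ for all $h\in\Gamma$ and $x\in\Gamma\times 2^\omega$, and (2) if $x\mathrel{G_\Gamma}y$ then $f(x)\mathrel{G}f(y)$.
   Context: $\mathcal{N}=\omega^\omega$. A graph on $X$ is a symmetric irreflexive subset of $X^2$. For a Borel graph $G$ on a space $X$, a countable group $\Gamma$, and an action $a$ of $\Gamma$ on $X$, a function $f:X\to\omega\times\Gamma$ is an $a$-coloring of $(G,a)$ if for every $n\in\omega$ the set $\{h\cdot_a x: x\in X,\ h\in\Gamma,\ f(x)=(n,h)\}$ is $G$-independent (contains no two $G$-adjacent points). A sequence $\langle(\gamma_n,s_n):n\in\omega\rangle$ with $(\gamma_n,s_n)\in\Gamma\times 2^n$ is generic if for each $\gamma\in\Gamma$ we have $\gamma=\gamma_n$ for infinitely many $n$, and every string in $2^{<\omega}$ is extended by some $s_n$. $G_\Gamma$ is the graph on $\Gamma\times 2^\omega$ in which $x,y$ are adjacent iff, for some $n\in\omega$ and $z\in 2^\omega$, $\{x,y\}=\{(\gamma_n,s_n\,0\,z),(\gamma_n,s_n\,1\,z)\}$,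 where juxtaposition of sequences denotes concatenation. The action $a_\Gamma$ of $\Gamma$ on $\Gamma\times 2^\omega$ is $\gamma\cdot(\gamma',z)=(\gamma\gamma',z)$. -}

module Defs where

open import Algebra.Bundles using (Group)
open import Data.Bool using (Bool; true; false)
open import Data.List using (List)
open import Data.List.Relation.Binary.Prefix.Heterogeneous using (Prefix)
open import Data.Nat using (ℕ; zero; suc; _<_; _≤_)
open import Data.Product using (_×_; _,_; ∃-syntax; proj₁; proj₂; uncurry)
open import Data.Product.Relation.Binary.Pointwise.NonDependent using (_×ₛ_)
open import Data.Sum using (_⊎_; inj₁; inj₂)
open import Data.Vec using (Vec; []; _∷_; toList)
open import Function.Bundles using (Func; Surjection)
open import Level using (0ℓ; Lift) renaming (suc to ℓsuc)
open import Relation.Binary.Bundles using (Setoid)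
open import Relation.Binary.Core using (Rel)
open import Relation.Binary.Definitions using (Symmetric; Irreflexive; _Respects_; _Respects₂_)
open import Relation.Binary.PropositionalEquality using (_≡_; _≗_; refl; setoid; _→-setoid_)
open import Relation.Nullary using (¬_)
open import Relation.Unary using (Pred; _∈_; _⊆_; _≐_; ∁; ⋃; _⟨×⟩_)

------------------------------------------------------------------------
-- Topological spaces and Borel sets

-- The points form a setoid, so that infinite sequences are compared
-- pointwise and function extensionality is not needed.

record Space : Set₂ where
  field
    points : Setoid 0ℓ 0ℓ
  open Setoid points public using (Carrier; _≈_)
  field
    Open : Pred Carrier 0ℓ → Set₁

discrete : Setoid 0ℓ 0ℓ → Space
discrete S = record
  { points = S
  ; Open   = λ U → Lift (ℓsuc 0ℓ) (U Respects Setoid._≈_ S)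
  }

infixr 2 _⊗_

_⊗_ : Space → Space → Space
X ⊗ Y = record
  { points = X.points ×ₛ Y.points
  ; Open   = λ W → ∀ {x y} → (x , y) ∈ W →
               ∃[ U ] ∃[ V ] X.Open U × Y.Open V ×
                 x ∈ U × y ∈ V × (U ⟨×⟩ V) ⊆ W
  }
  where
  module X = Space X
  module Y = Space Y

-- The countable power of the discrete space A: a set is open iff with
-- each x it contains every sequence that agrees with x below some n.

infix 8 _^ω

_^ω : Set → Space
A ^ω = record
  { points = ℕ →-setoid A
  ; Open   = λ U → Lift (ℓsuc 0ℓ) (∀ {x} → x ∈ U →
               ∃[ n ] (∀ y → (∀ i → i < n → x i ≡ y i) → y ∈ U))
  }

𝒩 : Space
𝒩 = ℕ ^ω

-- The σ-algebra generated by the open sets. Closure under ≐ identifies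
-- predicates with the same elements.

data Borel (X : Space) : Pred (Space.Carrier X) 0ℓ → Set₁ where
  open-set   : ∀ {A} → Space.Open X A → Borel X A
  complement : ∀ {A} → Borel X A → Borel X (∁ A)
  union      : ∀ {A : ℕ → Pred (Space.Carrier X) 0ℓ} →
               (∀ n → Borel X (A n)) → Borel X (⋃[ n ∶ ℕ ] A n)
  same       : ∀ {A B} → A ≐ B → Borel X A → Borel X B

BorelMap : (X Y : Space) → (Space.Carrier X → Space.Carrier Y) → Set₁
BorelMap X Y f = ∀ {B} → Borel Y B → Borel X (λ x → f x ∈ B)

------------------------------------------------------------------------
-- Graphs, actions, colorings and homomorphisms

record Graph (S : Setoid 0ℓ 0ℓ) : Set₁ where
  infix 4 _~_
  open Setoid S using (Carrier; _≈_)
  field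
    _~_      : Rel Carrier 0ℓ
    ~-resp   : _~_ Respects₂ _≈_
    ~-sym    : Symmetric _~_
    ~-irrefl : Irreflexive _≈_ _~_

  Independent : ∀ {ℓ} → Pred Carrier ℓ → Set ℓ
  Independent A = ∀ {x y} → x ∈ A → y ∈ A → ¬ (x ~ y)

BorelGraph : (X : Space) → Graph (Space.points X) → Set₁
BorelGraph X G = Borel (X ⊗ X) (uncurry (Graph._~_ G))

record Action (Γ : Group 0ℓ 0ℓ) (S : Setoid 0ℓ 0ℓ) : Set where
  infixr 7 _·_
  private module Γ = Group Γ
  open Setoid S using (Carrier; _≈_)
  field
    _·_    : Γ.Carrier → Carrier → Carrier
    ·-cong : ∀ {g h x y} → g Γ.≈ h → x ≈ y → g · x ≈ h · y
    ·-ε    : ∀ x → Γ.ε · x ≈ x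
    ·-∙    : ∀ g h x → (g Γ.∙ h) · x ≈ g · h · x

-- Γ carries the discrete topology.

BorelAction : (Γ : Group 0ℓ 0ℓ) (X : Space) → Action Γ (Space.points X) → Set₁
BorelAction Γ X a =
  BorelMap (discrete (Group.setoid Γ) ⊗ X) X (uncurry (Action._·_ a))

-- Every group is nonempty, so the countable (finite or infinite) groups
-- are those enumerated by ℕ, possibly with repetitions.

Countable : Group 0ℓ 0ℓ → Set
Countable Γ = Surjection (setoid ℕ) (Group.setoid Γ)

module _ (Γ : Group 0ℓ 0ℓ) where

  private module Γ = Group Γ

  Colors : Setoid 0ℓ 0ℓ
  Colors = setoid ℕ ×ₛ Γ.setoid

  module _ {S : Setoid 0ℓ 0ℓ} (G : Graph S) (a : Action Γ S) where
    open Setoid S using (Carrier; _≈_)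
    open Action a

    IsColoring : Func S Colors → Set
    IsColoring f = ∀ n → Graph.Independent G
      (λ y → ∃[ x ] ∃[ h ] Setoid._≈_ Colors (Func.to f x) (n , h) × y ≈ h · x)

  BorelColoring : (X : Space) → Graph (Space.points X) →
                  Action Γ (Space.points X) → Set₁
  BorelColoring X G a = ∃[ f ]
    BorelMap X (discrete Colors) (Func.to f) × IsColoring G a f

  record EquivariantHom {S T : Setoid 0ℓ 0ℓ}
                        (G : Graph S) (a : Action Γ S)
                        (H : Graph T) (b : Action Γ T) : Set where
    private
      module G = Graph G
      module H = Graph H
      module a = Action a
      module b = Action b
    field
      map : Func S T
    open Func map public using (to; cong)
    field
      equivariant  : ∀ h x → Setoid._≈_ T (to (h a.· x)) (h b.· to x)
      homomorphism : ∀ {x y} → x G.~ y → to x H.~ to y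

------------------------------------------------------------------------
-- The graph G_Γ and the action a_Γ on Γ × 2^ω

2^ω : Setoid 0ℓ 0ℓ
2^ω = Space.points (Bool ^ω)

infixr 5 _◂_ _⌢_

_◂_ : Bool → (ℕ → Bool) → (ℕ → Bool)
(b ◂ z) zero    = b
(b ◂ z) (suc i) = z i

_⌢_ : ∀ {n} → Vec Bool n → (ℕ → Bool) → (ℕ → Bool)
[]      ⌢ z = z
(b ∷ s) ⌢ z = b ◂ (s ⌢ z)

⌢-differ : ∀ {n} (s : Vec Bool n) (z w : ℕ → Bool) →
           ¬ (s ⌢ false ◂ z ≗ s ⌢ true ◂ w)
⌢-differ []      z w eq with () ← eq 0
⌢-differ (_ ∷ s) z w eq = ⌢-differ s z w (λ i → eq (suc i))

module _ (Γ : Group 0ℓ 0ℓ) where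

  private module Γ = Group Γ

  Γ×2^ω : Setoid 0ℓ 0ℓ
  Γ×2^ω = Γ.setoid ×ₛ 2^ω

  private module P = Setoid Γ×2^ω

  action-Γ : Action Γ Γ×2^ω
  action-Γ = record
    { _·_    = λ (g : Γ.Carrier) (x : P.Carrier) → (g Γ.∙ proj₁ x , proj₂ x)
    ; ·-cong = λ g≈h x≈y → Γ.∙-cong g≈h (proj₁ x≈y) , proj₂ x≈y
    ; ·-ε    = λ x → Γ.identityˡ (proj₁ x) , λ _ → refl
    ; ·-∙    = λ g h x → Γ.assoc g h (proj₁ x) , λ _ → refl
    }

  module _ (γ : ℕ → Γ.Carrier) (s : ∀ n → Vec Bool n) where

    record Generic : Set where
      field
        infinitely-often : ∀ g m → ∃[ n ] m ≤ n × g Γ.≈ γ n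
        dense            : ∀ (t : List Bool) → ∃[ n ] Prefix _≡_ t (toList (s n))

    end : Bool → ℕ → (ℕ → Bool) → P.Carrier
    end b n z = γ n , s n ⌢ b ◂ z

    -- Equality of unordered pairs, {x , y} = {u , v}, is spelled out.

    Adjacent : Rel P.Carrier 0ℓ
    Adjacent x y = ∃[ n ] ∃[ z ]
      ( (x P.≈ end false n z × y P.≈ end true n z)
      ⊎ (x P.≈ end true n z × y P.≈ end false n z))

    graph-Γ : Graph Γ×2^ω
    graph-Γ = record
      { _~_      = Adjacent
      ; ~-resp   = respʳ , respˡ
      ; ~-sym    = symm
      ; ~-irrefl = irrefl
      }
      where
      respʳ : ∀ {x y y′} → y P.≈ y′ → Adjacent x y → Adjacent x y′
      respʳ e (n , z , inj₁ (p , q)) = n , z , inj₁ (p , P.trans (P.sym e) q)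
      respʳ e (n , z , inj₂ (p , q)) = n , z , inj₂ (p , P.trans (P.sym e) q)

      respˡ : ∀ {y x x′} → x P.≈ x′ → Adjacent x y → Adjacent x′ y
      respˡ e (n , z , inj₁ (p , q)) = n , z , inj₁ (P.trans (P.sym e) p , q)
      respˡ e (n , z , inj₂ (p , q)) = n , z , inj₂ (P.trans (P.sym e) p , q)

      symm : Symmetric Adjacent
      symm (n , z , inj₁ (p , q)) = n , z , inj₂ (q , p)
      symm (n , z , inj₂ (p , q)) = n , z , inj₁ (q , p)

      irrefl : Irreflexive P._≈_ Adjacent
      irrefl e (n , z , inj₁ (p , q)) = ⌢-differ (s n) z z
        (proj₂ (P.trans (P.sym p) (P.trans e q)))
      irrefl e (n , z , inj₂ (p , q)) = ⌢-differ (s n) z z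
        (proj₂ (P.trans (P.sym q) (P.trans (P.sym e) p)))

{-# OPTIONS --safe #-}

-- Pulling G back along the elements γ n gives Borel relations
-- R n x y = γ n · x ~ γ n · y that no longer mention the action: countably many
-- Borel sets, each independent for some R n, that cover 𝒩 yield a coloring,
-- and a map φ on 2^ω with R n (φ (s n 0 z)) (φ (s n 1 z)) extends
-- equivariantly by (g , c) ↦ g · φ c.
--
-- A configuration of level n is a copy in R of the first n stages of the graph
-- on 2^n, with witnesses for its edges in the analytic relations R k. A
-- configuration of level n + 1 joins two of level n by an edge between their
-- points at s n. Discard from 𝒩 countably many Borel independent sets, enough
-- to destroy every basic open set of configurations that can be destroyed in
-- this way. Each surviving neighbourhood then extends to the next level: if it
-- did not, its points at s n would form an analytic R n-independent set, which
-- by separation lies in a Borel R n-independent set that destroys it. So a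
-- surviving configuration of level 0 grows into φ, and if there is none then
-- the discarded sets cover 𝒩.

module Submission where

open import Defs
open import Algebra.Bundles using (Group)
open import Axiom.ExcludedMiddle using (ExcludedMiddle)
open import Data.Bool using (Bool; true; false)
open import Data.Empty using (⊥; ⊥-elim)
open import Data.Nat using (ℕ; zero; suc; _+_; _⊔_; _<_; _≤_; z<s; s<s; s<s⁻¹; _<?_)
open import Data.Nat.Induction using (<-rec)
open import Data.Nat.Properties
open import Data.Product using (_×_; _,_; ∃-syntax; proj₁; proj₂; uncurry)
open import Data.Sum using (_⊎_; inj₁; inj₂)
open import Data.Unit using (⊤; tt)
open import Data.Vec using (Vec; []; _∷_)
open import Function using (_∘_; id)
open import Level using (0ℓ; lift)
open import Relation.Binary.Definitions using (_Respects_)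
open import Relation.Binary.PropositionalEquality
open import Relation.Nullary using (¬_; yes; no)
open import Relation.Nullary.Decidable using (decidable-stable)
open import Relation.Unary using (Pred; _∈_; _∉_; _⊆_; _≐_; ∁; _∩_; ⋂)

-- Finite agreement and limits of sequences

Seq : Set
Seq = ℕ → ℕ

infix 4 _≈[_]_

_≈[_]_ : Seq → ℕ → Seq → Set
x ≈[ n ] y = ∀ i → i < n → x i ≡ y i

≈-sym : ∀ {n x y} → x ≈[ n ] y → y ≈[ n ] x
≈-sym e i i<n = sym (e i i<n)

≈-trans : ∀ {n x y z} → x ≈[ n ] y → y ≈[ n ] z → x ≈[ n ] z
≈-trans e e′ i i<n = trans (e i i<n) (e′ i i<n)

≈-mono : ∀ {m n x y} → m ≤ n → x ≈[ n ] y → x ≈[ m ] y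
≈-mono m≤n e i i<m = e i (<-≤-trans i<m m≤n)

≗⇒≈ : ∀ {n x y} → x ≗ y → x ≈[ n ] y
≗⇒≈ e i _ = e i

Lipschitz : (Seq → Seq) → Set
Lipschitz f = ∀ {n x y} → x ≈[ n ] y → f x ≈[ n ] f y

Lipschitz⇒cong : ∀ {f} → Lipschitz f → ∀ {x y} → x ≗ y → f x ≗ f y
Lipschitz⇒cong lip e i = lip {suc i} (≗⇒≈ e) i ≤-refl

-- Entry `i` is read at stage `suc i`, because stage `d` is settled only below `d`.
limit : (ℕ → Seq) → Seq
limit y i = y (suc i) i

module _ {y : ℕ → Seq} (step : ∀ d → y d ≈[ d ] y (suc d)) where

  private
    later : ∀ d e → y d ≈[ d ] y (e + d)
    later d zero    i _   = refl
    later d (suc e) i i<d =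
      trans (later d e i i<d) (step (e + d) i (≤-trans i<d (m≤n+m d e)))

  limit-≈ : ∀ d → y d ≈[ d ] limit y
  limit-≈ d i i<d = sym (subst (λ e → y (suc i) i ≡ y e i)
    (m∸n+n≡m i<d) (later (suc i) _ i ≤-refl))

-- Names the child, with next entry `a`, of the cylinder of length `n` about `x`; `a` also fills the
-- places beyond.
_⟨_⟩≔_ : Seq → ℕ → ℕ → Seq
(x ⟨ n ⟩≔ a) i with i <? n
... | yes _ = x i
... | no  _ = a

≔-≈ : ∀ x n a → x ≈[ n ] x ⟨ n ⟩≔ a
≔-≈ x n a i i<n with i <? n
... | yes _   = refl
... | no  i≮n = ⊥-elim (i≮n i<n)

≔-covers : ∀ {x n y} → x ≈[ n ] y → x ⟨ n ⟩≔ y n ≈[ suc n ] y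
≔-covers {x} {n} {y} e i i≤n with i <? n
... | yes i<n = e i i<n
... | no  i≮n = cong y (≤-antisym (≮⇒≥ i≮n) (≤-pred i≤n))

-- Coding of pairs and of finite sequences

next : ℕ × ℕ → ℕ × ℕ
next (zero  , b) = suc b , zero
next (suc a , b) = a , suc b

unpair : ℕ → ℕ × ℕ
unpair zero    = zero , zero
unpair (suc n) = next (unpair n)

-- Cantor's walk: `unpair` enters each antidiagonal at `(m , zero)` right after finishing the
-- previous one, and `row` follows it to the desired pair.
unpair-surjective : ∀ a b → ∃[ k ] unpair k ≡ (a , b)
unpair-surjective a b = row b a (start (b + a))
  where
  row : ∀ b a → ∃[ k ] unpair k ≡ (b + a , zero) → ∃[ k ] unpair k ≡ (a , b)
  row zero    a p = p
  row (suc b) a p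
    with k , e ← row b (suc a) (subst (λ m → ∃[ k ] unpair k ≡ (m , zero)) (sym (+-suc b a)) p)
    = suc k , cong next e

  start : ∀ m → ∃[ k ] unpair k ≡ (m , zero)
  start zero    = zero , refl
  start (suc m)
    with k , e ← row m zero (subst (λ m → ∃[ k ] unpair k ≡ (m , zero)) (sym (+-identityʳ m)) (start m))
    = suc k , cong next e

pair : ℕ → ℕ → ℕ
pair a b = proj₁ (unpair-surjective a b)

unpair-pair : ∀ a b → unpair (pair a b) ≡ (a , b)
unpair-pair a b = proj₂ (unpair-surjective a b)

-- Sequences are paired valuewise, which makes pairing and both
-- projections Lipschitz.

⟪_,_⟫ : Seq → Seq → Seq
⟪ x , y ⟫ i = pair (x i) (y i)

left right : Seq → Seq
left  z i = proj₁ (unpair (z i))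
right z i = proj₂ (unpair (z i))

left-⟪⟫ : ∀ x y → left ⟪ x , y ⟫ ≗ x
left-⟪⟫ x y i = cong proj₁ (unpair-pair (x i) (y i))

right-⟪⟫ : ∀ x y → right ⟪ x , y ⟫ ≗ y
right-⟪⟫ x y i = cong proj₂ (unpair-pair (x i) (y i))

⟪⟫-cong : ∀ {n x x′ y y′} → x ≈[ n ] x′ → y ≈[ n ] y′ → ⟪ x , y ⟫ ≈[ n ] ⟪ x′ , y′ ⟫
⟪⟫-cong e e′ i i<n = cong₂ pair (e i i<n) (e′ i i<n)

left-lipschitz : Lipschitz left
left-lipschitz e i i<n = cong (proj₁ ∘ unpair) (e i i<n)

right-lipschitz : Lipschitz right
right-lipschitz e i i<n = cong (proj₂ ∘ unpair) (e i i<n)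

-- For fixed `n`, the numbers `k` code all strings of length `n`, padded with zeros, and so index
-- the cylinders of that length.
decode : ℕ → ℕ → Seq
decode zero    k i       = zero
decode (suc n) k zero    = proj₁ (unpair k)
decode (suc n) k (suc i) = decode n (proj₂ (unpair k)) i

decode-dense : ∀ n x → ∃[ k ] x ≈[ n ] decode n k
decode-dense zero    x = zero , λ _ ()
decode-dense (suc n) x with k , e ← decode-dense n (x ∘ suc)
  = pair (x 0) k , λ
  { zero    _   → sym (cong proj₁ (unpair-pair (x 0) k))
  ; (suc i) i<n → trans (e i (s<s⁻¹ i<n))
      (cong (λ p → decode n (proj₂ p) i) (sym (unpair-pair (x 0) k)))
  }

bounded : ∀ (f : ℕ → ℕ) n → ∃[ N ] (∀ i → i < n → f i < N)
bounded f zero = zero , λ _ ()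
bounded f (suc n) with N , b ← bounded (f ∘ suc) n = suc (f 0) ⊔ N , λ
  { zero    _   → m≤m⊔n (suc (f 0)) N
  ; (suc i) i<n → ≤-trans (b i (s<s⁻¹ i<n)) (m≤n⊔m (suc (f 0)) N)
  }

-- Borel sets

preimage-borel : ∀ {X Y} {f : Space.Carrier X → Space.Carrier Y} →
  (∀ {V} → Space.Open Y V → Borel X (V ∘ f)) → BorelMap X Y f
preimage-borel h (open-set o)       = h o
preimage-borel h (complement b)     = complement (preimage-borel h b)
preimage-borel h (union b)          = union (λ n → preimage-borel h (b n))
preimage-borel h (same (p , q) b)   = same (p , q) (preimage-borel h b)

continuous : {f : Seq → Seq} → Lipschitz f → BorelMap 𝒩 𝒩 f
continuous lip = preimage-borel λ (lift o) → open-set (lift λ fx∈V →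
  let n , nbhd = o fx∈V in n , λ y e → nbhd _ (lip e))

borel-resp : ∀ {A} → Borel 𝒩 A → A Respects _≗_
borel-resp (open-set (lift o)) e x∈A = let n , nbhd = o x∈A in nbhd _ (≗⇒≈ e)
borel-resp (complement b) e x∉A y∈A  = x∉A (borel-resp b (sym ∘ e) y∈A)
borel-resp (union b) e (n , x∈A)     = n , borel-resp (b n) e x∈A
borel-resp (same (p , q) b) e x∈A    = p (borel-resp b e (q x∈A))

constant-borel : ∀ (P : Set) → Borel 𝒩 (λ _ → P)
constant-borel P = open-set (lift λ p → 0 , λ _ _ → p)

cylinder-borel : ∀ n z → Borel 𝒩 (z ≈[ n ]_)
cylinder-borel n z = open-set (lift λ e → n , λ _ e′ → ≈-trans e e′)

Closed : Pred Seq 0ℓ → Set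
Closed D = ∀ {x} → (∀ n → ∃[ y ] x ≈[ n ] y × y ∈ D) → x ∈ D

module Classical (em : ∀ ℓ → ExcludedMiddle ℓ) where

  by-contradiction : ∀ {ℓ} {P : Set ℓ} → ¬ ¬ P → P
  by-contradiction = decidable-stable (em _)

  ⋂-borel : ∀ {A : ℕ → Pred Seq 0ℓ} → (∀ n → Borel 𝒩 (A n)) → Borel 𝒩 (⋂ ℕ A)
  ⋂-borel b = same
    ((λ h n → by-contradiction λ ¬A → h (n , ¬A)) , (λ h (n , ¬A) → ¬A (h n)))
    (complement (union (λ n → complement (b n))))

  ∩-borel : ∀ {A B} → Borel 𝒩 A → Borel 𝒩 B → Borel 𝒩 (A ∩ B)
  ∩-borel {A} {B} a b = same ((λ h → h 0 , h 1) , (λ (x∈A , x∈B) →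
    λ { zero → x∈A ; (suc _) → x∈B })) (⋂-borel {family} λ { zero → a ; (suc _) → b })
    where
    family : ℕ → Pred Seq 0ℓ
    family zero    = A
    family (suc _) = B

  closed-borel : ∀ {D} → Closed D → Borel 𝒩 D
  closed-borel {D} closed = same (by-contradiction , λ x∈D x∉D → x∉D x∈D)
    (complement (open-set {A = ∁ D} (lift λ {x} x∉D → by-contradiction λ none →
      x∉D (closed λ n → by-contradiction λ isolated →
        none (n , λ y e y∈D → isolated (y , e , y∈D))))))

  -- An open set of the product is a countable union of rectangles of cylinders. Inclusion in `W`
  -- enters as a constant set, which removes the other rectangles from the union.
  rectangle-borel : ∀ {p q : Seq → Seq} → BorelMap 𝒩 𝒩 p → BorelMap 𝒩 𝒩 q →
                    BorelMap 𝒩 (𝒩 ⊗ 𝒩) (λ z → p z , q z)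
  rectangle-borel {p} {q} pb qb = preimage-borel {Y = 𝒩 ⊗ 𝒩} λ {W} o →
    same ( (λ (n , k , l , sub , e , e′) → sub _ _ e e′)
         , λ {z} pq∈W → let _ , _ , lift oU , lift oV , p∈U , q∈V , UV⊆W = o pq∈W
                            m , U-nbhd = oU p∈U
                            n , V-nbhd = oV q∈V
                            k , ek = decode-dense (m ⊔ n) (p z)
                            l , el = decode-dense (m ⊔ n) (q z)
                        in m ⊔ n , k , l
                         , (λ x y ex ey → UV⊆W
                              ( U-nbhd x (≈-mono (m≤m⊔n m n) (≈-trans ek ex))
                              , V-nbhd y (≈-mono (m≤n⊔m m n) (≈-trans el ey))))
                         , ≈-sym ek , ≈-sym el )
      (union λ n → union λ k → union λ l →
        ∩-borel (constant-borel (∀ x y → decode n k ≈[ n ] x → decode n l ≈[ n ] y → (x , y) ∈ W))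
          (∩-borel (pb (cylinder-borel n (decode n k))) (qb (cylinder-borel n (decode n l)))))

  least : ∀ {P : Pred ℕ 0ℓ} → ∃[ n ] n ∈ P → ∃[ k ] k ∈ P × (∀ i → i < k → i ∉ P)
  least {P} (n , p) = <-rec (λ n → n ∈ P → ∃[ k ] k ∈ P × (∀ i → i < k → i ∉ P)) descent n p
    where
    descent : ∀ n → (∀ {m} → m < n → m ∈ P → ∃[ k ] k ∈ P × (∀ i → i < k → i ∉ P)) →
              n ∈ P → ∃[ k ] k ∈ P × (∀ i → i < k → i ∉ P)
    descent n rec p with em _ {∃[ i ] i < n × i ∈ P}
    ... | yes (i , i<n , q) = rec i<n q
    ... | no  none          = n , p , λ i i<n q → none (i , i<n , q)

  module FirstMember {B : ℕ → Pred Seq 0ℓ} (B-borel : ∀ k → Borel 𝒩 (B k))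
    (cover : ∀ x → ∃[ k ] x ∈ B k) where

    first : Seq → ℕ
    first x = proj₁ (least (cover x))

    first-∈ : ∀ x → x ∈ B (first x)
    first-∈ x = proj₁ (proj₂ (least (cover x)))

    first-minimal : ∀ {x k} → x ∈ B k → first x ≤ k
    first-minimal {x} x∈ = ≮⇒≥ λ k<first → proj₂ (proj₂ (least (cover x))) _ k<first x∈

    first-cong : ∀ {x y} → x ≗ y → first x ≡ first y
    first-cong {x} {y} e = ≤-antisym
      (first-minimal (borel-resp (B-borel _) (sym ∘ e) (first-∈ y)))
      (first-minimal (borel-resp (B-borel _) e (first-∈ x)))

    -- Being in `B k` and in no earlier set is a Borel condition, and any set of values is a
    -- countable union of such conditions.
    first-borel : ∀ (P : Pred ℕ 0ℓ) → Borel 𝒩 (λ x → first x ∈ P)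
    first-borel P = same
      ( (λ (k , p , x∈ , minimal) → subst P (≤-antisym
          (≮⇒≥ λ first<k → minimal _ first<k (first-∈ _)) (first-minimal x∈)) p)
      , (λ {x} p → first x , p , first-∈ x , λ i i<first x∈ →
          <⇒≱ i<first (first-minimal x∈)) )
      (union λ k → ∩-borel (constant-borel (k ∈ P)) (∩-borel (B-borel k)
        (⋂-borel λ i → before k i)))
      where
      before : ∀ k i → Borel 𝒩 (λ x → i < k → x ∉ B i)
      before k i with i <? k
      ... | yes i<k = same ((λ x∉ _ → x∉) , (λ h → h i<k)) (complement (B-borel i))
      ... | no  i≮k = same ((λ _ i<k → ⊥-elim (i≮k i<k)) , _) (constant-borel ⊤)

  -- Analytic sets

  Closed₂ : (Seq → Seq → Set) → Set
  Closed₂ C = ∀ {x w} → (∀ n → ∃[ x′ ] ∃[ w′ ] x ≈[ n ] x′ × w ≈[ n ] w′ × C x′ w′) → C x w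

  closed₂-resp : ∀ {C} → Closed₂ C → ∀ {x x′ w w′} → x ≗ x′ → w ≗ w′ → C x w → C x′ w′
  closed₂-resp closed e e′ c = closed λ n → _ , _ , ≗⇒≈ (sym ∘ e) , ≗⇒≈ (sym ∘ e′) , c

  -- A projection of a closed set of pairs: the second coordinate certifies membership, and limits
  -- of certified points stay certified.
  record Analytic (A : Pred Seq 0ℓ) : Set₁ where
    field
      relation : Seq → Seq → Set
      closed   : Closed₂ relation
      witness  : ∀ {x} → x ∈ A → ∃[ w ] relation x w
      sound    : ∀ {x w} → relation x w → x ∈ A

  open Analytic

  analytic-≐ : ∀ {A B} → A ≐ B → Analytic A → Analytic B
  analytic-≐ (A⊆B , B⊆A) a = record
    { relation = relation a
    ; closed   = closed a
    ; witness  = λ x∈B → witness a (B⊆A x∈B)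
    ; sound    = λ r → A⊆B (sound a r)
    }

  open-analytic : ∀ {A} → Space.Open 𝒩 A → Analytic A
  open-analytic {A} (lift o) = record
    { relation = λ x w → ∀ y → x ≈[ w 0 ] y → y ∈ A
    ; closed   = λ {x} {w} h y e →
        -- The extra entry makes `w′` agree with `w` at 0 even if the radius `w 0` is 0.
        let x′ , w′ , ex , ew , inside = h (suc (w 0))
        in inside y (subst (x′ ≈[_] y) (ew 0 z<s)
             (≈-trans (≈-sym (≈-mono (n≤1+n _) ex)) e))
    ; witness  = λ x∈A → let n , nbhd = o x∈A in (λ _ → n) , nbhd
    ; sound    = λ inside → inside _ (λ _ _ → refl)
    }

  ∁-open-analytic : ∀ {A} → Space.Open 𝒩 A → Analytic (∁ A)
  ∁-open-analytic {A} (lift o) = record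
    { relation = λ x _ → x ∈ ∁ A
    ; closed   = λ h x∈A →
        let n , nbhd = o x∈A
            x′ , _ , e , _ , x′∉A = h n
        in x′∉A (nbhd x′ e)
    ; witness  = λ x∉A → (λ _ → 0) , x∉A
    ; sound    = id
    }

  ⋃-analytic : ∀ {A : ℕ → Pred Seq 0ℓ} → (∀ n → Analytic (A n)) → Analytic (λ x → ∃[ n ] x ∈ A n)
  ⋃-analytic a = record
    { relation = λ x w → relation (a (w 0)) x (w ∘ suc)
    ; closed   = λ {x} {w} h → closed (a (w 0)) λ n →
        let x′ , w′ , ex , ew , r = h (suc n)
        in x′ , w′ ∘ suc , ≈-mono (n≤1+n n) ex , (λ i i<n → ew (suc i) (s<s i<n))
         , subst (λ k → relation (a k) x′ (w′ ∘ suc)) (sym (ew 0 z<s)) r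
    ; witness  = λ (n , x∈A) → let w , r = witness (a n) x∈A
                               in (λ { zero → n ; (suc i) → w i }) , r
    ; sound    = λ {x} {w} r → w 0 , sound (a (w 0)) r
    }

  -- One sequence interleaves certificates for all the sets, the `k`-th at the places `pair k i`.
  ⋂-analytic : ∀ {A : ℕ → Pred Seq 0ℓ} → (∀ n → Analytic (A n)) → Analytic (⋂ ℕ A)
  ⋂-analytic a = record
    { relation = λ x w → ∀ k → relation (a k) x (λ i → w (pair k i))
    ; closed   = λ {x} {w} h k → closed (a k) λ n →
        -- Fixing `n` entries of the `k`-th certificate takes `w` up to the largest place `pair k i`
        -- with `i < n`.
        let N , b = bounded (pair k) n
            x′ , w′ , ex , ew , r = h (n ⊔ N)
        in x′ , _ , ≈-mono (m≤m⊔n n N) ex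
         , (λ i i<n → ew (pair k i) (≤-trans (b i i<n) (m≤n⊔m n N))) , r k
    ; witness  = λ {x} x∈A →
        let w = λ k → proj₁ (witness (a k) (x∈A k))
        in (λ i → uncurry w (unpair i))
         , λ k → closed₂-resp (closed (a k)) (λ _ → refl)
             (λ i → cong (uncurry w) (sym (unpair-pair k i)))
             (proj₂ (witness (a k) (x∈A k)))
    ; sound    = λ r k → sound (a k) (r k)
    }

  -- The induction carries the complement along, since analytic sets are closed under countable
  -- unions and intersections but not under complements.
  borel-bianalytic : ∀ {A} → Borel 𝒩 A → Analytic A × Analytic (∁ A)
  borel-bianalytic (open-set o)   = open-analytic o , ∁-open-analytic o
  borel-bianalytic (complement b) = let a , a′ = borel-bianalytic b in
    a′ , analytic-≐ ((λ x∈A x∉A → x∉A x∈A) , by-contradiction) a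
  borel-bianalytic (union b) =
      ⋃-analytic (λ n → proj₁ (borel-bianalytic (b n)))
    , analytic-≐ ((λ h (n , x∈A) → h n x∈A) , λ h n x∈A → h (n , x∈A))
        (⋂-analytic (λ n → proj₂ (borel-bianalytic (b n))))
  borel-bianalytic (same (p , q) b) = let a , a′ = borel-bianalytic b in
    analytic-≐ (p , q) a , analytic-≐ ((λ x∉A → x∉A ∘ q) , (λ x∉B → x∉B ∘ p)) a′

  borel-analytic : ∀ {A} → Borel 𝒩 A → Analytic A
  borel-analytic = proj₁ ∘ borel-bianalytic

  -- Separation

  module Separation {D E : Pred Seq 0ℓ} (D-closed : Closed D) (E-closed : Closed E)
    {f g h : Seq → Seq}
    (f-lip : Lipschitz f) (g-lip : Lipschitz g) (h-lip : Lipschitz h) where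

    -- Luzin separation in rectangular form: a Borel rectangle parts the product of two pieces of
    -- the image `f[D]` from a piece of the analytic relation formed by the pairs `(g e , h e)`.
    record Separated (n : ℕ) (x y z : Seq) : Set₁ where
      field
        {B C}    : Pred Seq 0ℓ
        B-borel  : Borel 𝒩 B
        C-borel  : Borel 𝒩 C
        coversˡ  : ∀ {d} → d ∈ D → x ≈[ n ] d → f d ∈ B
        coversʳ  : ∀ {d} → d ∈ D → y ≈[ n ] d → f d ∈ C
        disjoint : ∀ {e} → e ∈ E → z ≈[ n ] e → g e ∈ B → h e ∈ C → ⊥

    open Separated

    -- The quantifiers let a point of `D` fix its own next entry once and for all, while for `e`
    -- with next entry `c` the two conditions meet at a common triple `(a , b , c)`.
    glue : ∀ {n x y z} →
      (∀ a b c → Separated (suc n) (x ⟨ n ⟩≔ a) (y ⟨ n ⟩≔ b) (z ⟨ n ⟩≔ c)) →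
      Separated n x y z
    glue {n} sep = record
      { B        = λ u → ∀ c → ∃[ a ] ∀ b → u ∈ B (sep a b c)
      ; C        = λ u → ∀ c → ∃[ b ] ∀ a → u ∈ C (sep a b c)
      ; B-borel  = ⋂-borel λ c → union λ a → ⋂-borel λ b → B-borel (sep a b c)
      ; C-borel  = ⋂-borel λ c → union λ b → ⋂-borel λ a → C-borel (sep a b c)
      ; coversˡ  = λ {d} d∈D x≈d c → d n , λ b → coversˡ (sep (d n) b c) d∈D (≔-covers x≈d)
      ; coversʳ  = λ {d} d∈D y≈d c → d n , λ a → coversʳ (sep a (d n) c) d∈D (≔-covers y≈d)
      ; disjoint = λ {e} e∈E z≈e ge∈B he∈C →
          let a , ge∈ = ge∈B (e n)
              b , he∈ = he∈C (e n)
          in disjoint (sep a b (e n)) e∈E (≔-covers z≈e) (ge∈ b) (he∈ a)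
      }

    Inseparable : ℕ → Set₁
    Inseparable n = ∃[ x ] ∃[ y ] ∃[ z ] ¬ Separated n x y z

    extend : ∀ {n x y z} → ¬ Separated n x y z →
      ∃[ x′ ] ∃[ y′ ] ∃[ z′ ] x ≈[ n ] x′ × y ≈[ n ] y′ × z ≈[ n ] z′ ×
        ¬ Separated (suc n) x′ y′ z′
    extend {n} {x} {y} {z} ¬sep = by-contradiction λ none → ¬sep (glue λ a b c →
      by-contradiction λ ¬sep′ →
        none (_ , _ , _ , ≔-≈ x n a , ≔-≈ y n b , ≔-≈ z n c , ¬sep′))

    -- Inseparable neighbourhoods shrink to points x, y ∈ D and z ∈ E with
    -- f x = g z and f y = h z.

    module _ (¬sep : ¬ Separated 0 (λ _ → 0) (λ _ → 0) (λ _ → 0)) where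

      stage : ∀ n → Inseparable n
      stage zero    = _ , _ , _ , ¬sep
      stage (suc n) =
        let _ , _ , _ , ¬sepₙ = stage n
            x′ , y′ , z′ , _ , _ , _ , ¬sep′ = extend ¬sepₙ
        in x′ , y′ , z′ , ¬sep′

      xs ys zs : ℕ → Seq
      xs n = proj₁ (stage n)
      ys n = proj₁ (proj₂ (stage n))
      zs n = proj₁ (proj₂ (proj₂ (stage n)))

      inseparable : ∀ n → ¬ Separated n (xs n) (ys n) (zs n)
      inseparable n = proj₂ (proj₂ (proj₂ (stage n)))

      xs-≈ : ∀ n → xs n ≈[ n ] limit xs
      xs-≈ = limit-≈ λ n → let _ , _ , _ , e , _ = extend (inseparable n) in e

      ys-≈ : ∀ n → ys n ≈[ n ] limit ys
      ys-≈ = limit-≈ λ n → let _ , _ , _ , _ , e , _ = extend (inseparable n) in e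

      zs-≈ : ∀ n → zs n ≈[ n ] limit zs
      zs-≈ = limit-≈ λ n → let _ , _ , _ , _ , _ , e , _ = extend (inseparable n) in e

      -- If `D` missed the cylinder of length `n` about the limit, the empty set and the whole space
      -- would separate.
      x∈D : limit xs ∈ D
      x∈D = D-closed λ n → by-contradiction λ none → inseparable n (record
        { B-borel  = constant-borel ⊥
        ; C-borel  = constant-borel ⊤
        ; coversˡ  = λ d∈D e → none (_ , ≈-trans (≈-sym (xs-≈ n)) e , d∈D)
        ; coversʳ  = λ _ _ → tt
        ; disjoint = λ _ _ ()
        })

      y∈D : limit ys ∈ D
      y∈D = D-closed λ n → by-contradiction λ none → inseparable n (record
        { B-borel  = constant-borel ⊤
        ; C-borel  = constant-borel ⊥
        ; coversˡ  = λ _ _ → tt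
        ; coversʳ  = λ d∈D e → none (_ , ≈-trans (≈-sym (ys-≈ n)) e , d∈D)
        ; disjoint = λ _ _ _ ()
        })

      z∈E : limit zs ∈ E
      z∈E = E-closed λ n → by-contradiction λ none → inseparable n (record
        { B-borel  = constant-borel ⊤
        ; C-borel  = constant-borel ⊤
        ; coversˡ  = λ _ _ → tt
        ; coversʳ  = λ _ _ → tt
        ; disjoint = λ e∈E e _ _ → none (_ , ≈-trans (≈-sym (zs-≈ n)) e , e∈E)
        })

      value-borel : ∀ (P : Pred ℕ 0ℓ) i → Borel 𝒩 (λ u → P (u i))
      value-borel P i = open-set (lift λ p →
        suc i , λ y e → subst P (e i ≤-refl) p)

      -- By the Lipschitz conditions `suc i` entries fix both values at `i`, so a difference there
      -- would separate.
      fx≗gz : f (limit xs) ≗ g (limit zs)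
      fx≗gz i = by-contradiction λ fx≢gz → inseparable (suc i) (record
        { B-borel  = value-borel (f (limit xs) i ≡_) i
        ; C-borel  = constant-borel ⊤
        ; coversˡ  = λ _ e → f-lip (≈-trans (≈-sym (xs-≈ (suc i))) e) i ≤-refl
        ; coversʳ  = λ _ _ → tt
        ; disjoint = λ _ e fx≡ge _ → fx≢gz (trans fx≡ge
            (sym (g-lip (≈-trans (≈-sym (zs-≈ (suc i))) e) i ≤-refl)))
        })

      fy≗hz : f (limit ys) ≗ h (limit zs)
      fy≗hz i = by-contradiction λ fy≢hz → inseparable (suc i) (record
        { B-borel  = constant-borel ⊤
        ; C-borel  = value-borel (f (limit ys) i ≡_) i
        ; coversˡ  = λ _ _ → tt
        ; coversʳ  = λ _ e → f-lip (≈-trans (≈-sym (ys-≈ (suc i))) e) i ≤-refl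
        ; disjoint = λ _ e _ fy≡he → fy≢hz (trans fy≡he
            (sym (h-lip (≈-trans (≈-sym (zs-≈ (suc i))) e) i ≤-refl)))
        })

    separate : (∀ {x y z} → x ∈ D → y ∈ D → z ∈ E → f x ≗ g z → f y ≗ h z → ⊥) →
      ∃[ A ] Borel 𝒩 A × (∀ {d} → d ∈ D → f d ∈ A) ×
             (∀ {e} → e ∈ E → g e ∈ A → h e ∈ A → ⊥)
    separate independent =
      let sep = by-contradiction λ ¬sep → independent
                  (x∈D ¬sep) (y∈D ¬sep) (z∈E ¬sep) (fx≗gz ¬sep) (fy≗hz ¬sep)
      -- At level 0 both factors cover all of `f[D]`, so their intersection serves as the one set.
      in (B sep ∩ C sep) , ∩-borel (B-borel sep) (C-borel sep)
       , (λ d∈D → coversˡ sep d∈D (λ _ ()) , coversʳ sep d∈D (λ _ ()))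
       , (λ e∈E ge∈ he∈ → disjoint sep e∈E (λ _ ()) (proj₁ ge∈) (proj₂ he∈))

  -- Borel `V` and `Q` become closed once each point is paired with a certificate, and projecting to
  -- the point keeps the three maps Lipschitz.
  image-separation : ∀ {V Q f g h} → Borel 𝒩 V → Borel 𝒩 Q →
    Lipschitz f → Lipschitz g → Lipschitz h →
    (∀ {x y z} → x ∈ V → y ∈ V → z ∈ Q → f x ≗ g z → f y ≗ h z → ⊥) →
    ∃[ A ] Borel 𝒩 A × (∀ {x} → x ∈ V → f x ∈ A) ×
           (∀ {z} → z ∈ Q → g z ∈ A → h z ∈ A → ⊥)
  image-separation {V} {Q} {f} {g} {h} V-borel Q-borel f-lip g-lip h-lip independent =
    let A , A-borel , covers , disjoint = Separation.separate
          (graph-closed a) (graph-closed b) {f ∘ left} {g ∘ left} {h ∘ left}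
          (f-lip ∘ left-lipschitz) (g-lip ∘ left-lipschitz) (h-lip ∘ left-lipschitz)
          (λ r r′ r″ → independent (sound a r) (sound a r′) (sound b r″))
    in A , A-borel
     , (λ {x} x∈V → let w , r = witness a x∈V in
          borel-resp A-borel (Lipschitz⇒cong f-lip (left-⟪⟫ x w)) (covers {⟪ x , w ⟫} (on-pair a r)))
     , (λ {z} z∈Q gz∈A hz∈A → let w , r = witness b z∈Q in
          disjoint {⟪ z , w ⟫} (on-pair b r)
            (borel-resp A-borel (Lipschitz⇒cong g-lip (sym ∘ left-⟪⟫ z w)) gz∈A)
            (borel-resp A-borel (Lipschitz⇒cong h-lip (sym ∘ left-⟪⟫ z w)) hz∈A))
    where
    a = borel-analytic V-borel
    b = borel-analytic Q-borel

    graph-closed : ∀ {A} (a : Analytic A) → Closed (λ u → relation a (left u) (right u))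
    graph-closed a c = closed a λ n → let u , e , r = c n in
      left u , right u , left-lipschitz e , right-lipschitz e , r

    on-pair : ∀ {A} (a : Analytic A) {x w} → relation a x w →
              relation a (left ⟪ x , w ⟫) (right ⟪ x , w ⟫)
    on-pair a {x} {w} = closed₂-resp (closed a) (sym ∘ left-⟪⟫ x w) (sym ∘ right-⟪⟫ x w)

  -- The dichotomy for a sequence of Borel relations

  -- A configuration of level `suc n` is coded as `⟪ x , ⟪ y , w ⟫ ⟫`, with halves `x` and `y` of
  -- level `n` and `w` certifying the edge between them.
  branch : Bool → Seq → Seq
  branch false z = left z
  branch true  z = left (right z)

  last : Seq → Seq
  last z = right (right z)

  join : Seq → Seq → Seq → Seq
  join x y w = ⟪ x , ⟪ y , w ⟫ ⟫

  branch-lipschitz : ∀ b → Lipschitz (branch b)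
  branch-lipschitz false e = left-lipschitz e
  branch-lipschitz true  e = left-lipschitz (right-lipschitz e)

  last-lipschitz : Lipschitz last
  last-lipschitz e = right-lipschitz (right-lipschitz e)

  branch-false-join : ∀ x y w → branch false (join x y w) ≗ x
  branch-false-join x y w = left-⟪⟫ x ⟪ y , w ⟫

  branch-true-join : ∀ x y w → branch true (join x y w) ≗ y
  branch-true-join x y w i =
    trans (cong (proj₁ ∘ unpair) (right-⟪⟫ x ⟪ y , w ⟫ i)) (left-⟪⟫ y w i)

  last-join : ∀ x y w → last (join x y w) ≗ w
  last-join x y w i =
    trans (cong (proj₂ ∘ unpair) (right-⟪⟫ x ⟪ y , w ⟫ i)) (right-⟪⟫ y w i)

  -- The vertex `t` of a configuration. The top level splits by the last bit of `t`, which is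
  -- therefore the first to act on `z`.
  point : ∀ {n} → Vec Bool n → Seq → Seq
  point []      z = z
  point (b ∷ t) z = branch b (point t z)

  point-lipschitz : ∀ {n} (t : Vec Bool n) → Lipschitz (point t)
  point-lipschitz []      e = e
  point-lipschitz (b ∷ t) e = branch-lipschitz b (point-lipschitz t e)

  descend : (ℕ → Bool) → ℕ → Seq → Seq
  descend c zero    z = z
  descend c (suc d) z = branch (c 0) (descend (c ∘ suc) d z)

  descend-lipschitz : ∀ c d → Lipschitz (descend c d)
  descend-lipschitz c zero    e = e
  descend-lipschitz c (suc d) e = branch-lipschitz (c 0) (descend-lipschitz (c ∘ suc) d e)

  descend-cong : ∀ {c c′} → c ≗ c′ → ∀ d z → descend c d z ≡ descend c′ d z
  descend-cong e zero    z = refl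
  descend-cong e (suc d) z = cong₂ branch (e 0) (descend-cong (e ∘ suc) d z)

  -- The recursion peels off the lowest level; this peels off the top one, where successive
  -- approximations are compared.
  descend-suc : ∀ c d z → descend c (suc d) z ≡ descend c d (branch (c d) z)
  descend-suc c zero    z = refl
  descend-suc c (suc d) z = cong (branch (c 0)) (descend-suc (c ∘ suc) d z)

  module Dichotomy
    (R : ℕ → Seq → Seq → Set)
    (R-resp : ∀ n {x x′ y y′} → x ≗ x′ → y ≗ y′ → R n x y → R n x′ y′)
    (R-borel : ∀ n → Borel 𝒩 (λ z → R n (left z) (right z)))
    (s : ∀ n → Vec Bool n)
    where

    private
      E : ∀ n → Analytic (λ z → R n (left z) (right z))
      E n = borel-analytic (R-borel n)

    -- The discarded sets. Later `index k` selects the group element in the color of the points of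
    -- member `k`.
    record Family : Set₁ where
      field
        member      : ℕ → Pred Seq 0ℓ
        borel       : ∀ k → Borel 𝒩 (member k)
        index       : ℕ → ℕ
        independent : ∀ k {x y} → x ∈ member k → y ∈ member k → ¬ R (index k) x y

    open Family

    empty : Family
    empty = record
      { member      = λ _ _ → ⊥
      ; borel       = λ _ → constant-borel ⊥
      ; index       = λ _ → 0
      ; independent = λ _ ()
      }

    adjoin : ∀ n {A} → Borel 𝒩 A → (∀ {x y} → x ∈ A → y ∈ A → ¬ R n x y) →
             Family → Family
    adjoin n {A} A-borel A-independent F = record
      { member      = λ { zero → A ; (suc k) → member F k }
      ; borel       = λ { zero → A-borel ; (suc k) → borel F k }
      ; index       = λ { zero → n ; (suc k) → index F k }
      ; independent = λ { zero → A-independent ; (suc k) → independent F k }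
      }

    merge : (ℕ → Family) → Family
    merge F = record
      { member      = λ k → let i , j = unpair k in member (F i) j
      ; borel       = λ k → let i , j = unpair k in borel (F i) j
      ; index       = λ k → let i , j = unpair k in index (F i) j
      ; independent = λ k → let i , j = unpair k in independent (F i) j
      }

    Avoids : Family → Pred Seq 0ℓ
    Avoids F x = ∀ k → x ∉ member F k

    avoids-merge : ∀ F i {x} → x ∈ Avoids (merge F) → x ∈ Avoids (F i)
    avoids-merge F i {x} av j x∈ = av (pair i j)
      (subst (λ p → x ∈ member (F (proj₁ p)) (proj₂ p)) (sym (unpair-pair i j)) x∈)

    -- Keeping the certificate inside `z` makes the edge a closed condition, so that it survives
    -- limits.
    Edge : ℕ → Pred Seq 0ℓ
    Edge n z = Analytic.relation (E n)
      ⟪ point (s n) (branch false z) , point (s n) (branch true z) ⟫ (last z)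

    edge-closed : ∀ n → Closed (Edge n)
    edge-closed n h = Analytic.closed (E n) λ k → let y , e , edge = h k in _ , _
      , ⟪⟫-cong (point-lipschitz (s n) (branch-lipschitz false e))
                (point-lipschitz (s n) (branch-lipschitz true e))
      , last-lipschitz e , edge

    edge-sound : ∀ n {z} → z ∈ Edge n →
      R n (point (s n) (branch false z)) (point (s n) (branch true z))
    edge-sound n {z} edge = R-resp n (left-⟪⟫ x y) (right-⟪⟫ x y)
      (Analytic.sound (E n) {⟪ x , y ⟫} edge)
      where
      x = point (s n) (branch false z)
      y = point (s n) (branch true z)

    edge-join : ∀ n {x y} → R n (point (s n) x) (point (s n) y) →
      ∃[ w ] join x y w ∈ Edge n
    edge-join n {x} {y} r =
      let w , e = Analytic.witness (E n) (R-resp n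
                    (sym ∘ left-⟪⟫ (point (s n) x) (point (s n) y))
                    (sym ∘ right-⟪⟫ (point (s n) x) (point (s n) y)) r)
      in w , closed₂-resp (Analytic.closed (E n))
        (λ i → cong₂ pair
          (Lipschitz⇒cong (point-lipschitz (s n)) (sym ∘ branch-false-join x y w) i)
          (Lipschitz⇒cong (point-lipschitz (s n)) (sym ∘ branch-true-join x y w) i))
        (sym ∘ last-join x y w) e

    Valid : Family → ℕ → Pred Seq 0ℓ
    Valid F zero    = Avoids F
    Valid F (suc n) = λ z → branch false z ∈ Valid F n × branch true z ∈ Valid F n × z ∈ Edge n

    valid-borel : ∀ F n → Borel 𝒩 (Valid F n)
    valid-borel F zero    = ⋂-borel (λ k → complement (borel F k))
    valid-borel F (suc n) =
      ∩-borel (continuous (branch-lipschitz false) (valid-borel F n))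
        (∩-borel (continuous (branch-lipschitz true) (valid-borel F n))
          (closed-borel (edge-closed n)))

    valid-branch : ∀ F n b {z} → z ∈ Valid F (suc n) → branch b z ∈ Valid F n
    valid-branch F n false = proj₁
    valid-branch F n true  = proj₁ ∘ proj₂

    valid-mono : ∀ {F F′} → Avoids F ⊆ Avoids F′ → ∀ n → Valid F n ⊆ Valid F′ n
    valid-mono sub zero    v            = sub v
    valid-mono sub (suc n) (v , v′ , e) = valid-mono sub n v , valid-mono sub n v′ , e

    valid-point : ∀ F {n} (t : Vec Bool n) m {z} → z ∈ Valid F (n + m) → point t z ∈ Valid F m
    valid-point F []              m v = v
    valid-point F {suc n} (b ∷ t) m {z} v = valid-branch F m b
      (valid-point F t (suc m) (subst (λ k → z ∈ Valid F k) (sym (+-suc n m)) v))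

    valid-descend : ∀ F c d m {z} → z ∈ Valid F (d + m) → descend c d z ∈ Valid F m
    valid-descend F c zero    m v = v
    valid-descend F c (suc d) m {z} v = valid-branch F m (c 0)
      (valid-descend F (c ∘ suc) d (suc m) (subst (λ k → z ∈ Valid F k) (sym (+-suc d m)) v))

    -- No family destroys the neighbourhood. Its radius is the level, so agreement improves as
    -- configurations grow.
    Persistent : ℕ → Seq → Set₁
    Persistent n z = ∀ F → ∃[ z′ ] z ≈[ n ] z′ × z′ ∈ Valid F n

    -- Only countably many neighbourhoods have to be destroyed.

    saturated : ∃[ F ] (∀ n {z} → z ∈ Valid F n → Persistent n z)
    saturated = F∞ , λ n {z} v F →
        let k , e = decode-dense n z
            -- Being valid for all of `F∞`, `z` has survived the family chosen to destroy its own
            -- neighbourhood.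
            z′ , e′ , v′ = persistent n k (z , ≈-sym e , valid-mono (λ av →
              avoids-merge (destroyer n) k (avoids-merge (λ m → merge (destroyer m)) n av)) n v) F
        in z′ , ≈-trans e e′ , v′
      where
      choose : ∀ n k → ∃[ F ] ((∃[ z ] decode n k ≈[ n ] z × z ∈ Valid F n) → Persistent n (decode n k))
      choose n k with em _ {∃[ F ] ¬ (∃[ z ] decode n k ≈[ n ] z × z ∈ Valid F n)}
      ... | yes (F , dead) = F , ⊥-elim ∘ dead
      ... | no  alive      = empty , λ _ F → by-contradiction λ dead → alive (F , dead)

      destroyer : ℕ → ℕ → Family
      destroyer n k = proj₁ (choose n k)

      persistent : ∀ n k → (∃[ z ] decode n k ≈[ n ] z × z ∈ Valid (destroyer n k) n) →
                   Persistent n (decode n k)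
      persistent n k = proj₂ (choose n k)

      F∞ : Family
      F∞ = merge λ n → merge (destroyer n)

    F∞ : Family
    F∞ = proj₁ saturated

    Extension : ℕ → Seq → Seq → Set
    Extension n z z′ = z′ ∈ Valid F∞ (suc n) × (∀ b → z ≈[ n ] branch b z′)

    -- Otherwise the points at s n of the configurations near z would form
    -- an R n-independent set, and adjoining a Borel independent superset to
    -- F∞ would leave no configuration near z.

    extension : ∀ n {z} → z ∈ Valid F∞ n → ∃[ z′ ] Extension n z z′
    extension n {z} v = by-contradiction λ none →
      let near-borel = ∩-borel (cylinder-borel n z) (valid-borel F∞ n)
          A , A-borel , covers , disjoint = image-separation near-borel (R-borel n)
            (point-lipschitz (s n)) left-lipschitz right-lipschitz
            (λ {x} {y} (ex , vx) (ey , vy) r x≗ y≗ →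
              let w , edge = edge-join n {x} {y} (R-resp n (sym ∘ x≗) (sym ∘ y≗) r)
                  x≗′ = branch-false-join x y w
                  y≗′ = branch-true-join x y w
              in none (join x y w
                , ( borel-resp (valid-borel F∞ n) (sym ∘ x≗′) vx
                  , borel-resp (valid-borel F∞ n) (sym ∘ y≗′) vy
                  , edge )
                , λ { false → ≈-trans ex (≗⇒≈ (sym ∘ x≗′))
                    ; true  → ≈-trans ey (≗⇒≈ (sym ∘ y≗′)) }))
          F = adjoin n A-borel (λ {x} {y} x∈A y∈A r →
                let x≗ = sym ∘ left-⟪⟫ x y
                    y≗ = sym ∘ right-⟪⟫ x y
                in disjoint {⟪ x , y ⟫} (R-resp n x≗ y≗ r)
                     (borel-resp A-borel x≗ x∈A) (borel-resp A-borel y≗ y∈A)) F∞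
          z′ , e , v′ = proj₂ saturated n v F
          v∞ = valid-mono (λ av k → av (suc k)) n v′
      -- The vertex of `z′` at `s n` lies in `A`, which is member 0 of `F`, yet it must avoid `F`.
      in valid-point F (s n) 0 (subst (λ k → z′ ∈ Valid F k) (sym (+-identityʳ n)) v′) 0
           (covers (e , v∞))

    -- The limit map on 2^ω

    module Homomorphism (z₀ : Seq) (v₀ : z₀ ∈ Avoids F∞) where

      stage : ∀ n → ∃[ z ] z ∈ Valid F∞ n
      stage zero    = z₀ , v₀
      stage (suc n) = let z′ , v′ , _ = extension n (proj₂ (stage n)) in z′ , v′

      Z : ℕ → Seq
      Z n = proj₁ (stage n)

      Z-valid : ∀ n → Z n ∈ Valid F∞ n
      Z-valid n = proj₂ (stage n)

      Z-≈ : ∀ n b → Z n ≈[ n ] branch b (Z (suc n))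
      Z-≈ n = let _ , _ , e = extension n (Z-valid n) in e

      approximant : ℕ → (ℕ → Bool) → ℕ → Seq
      approximant m c d = descend c d (Z (d + m))

      -- Both halves of `Z (suc d + m)` agree with `Z (d + m)` below `d + m`, and descending is
      -- Lipschitz.
      approximant-≈ : ∀ m c d → approximant m c d ≈[ d ] approximant m c (suc d)
      approximant-≈ m c d = subst (approximant m c d ≈[ d ]_)
        (sym (descend-suc c d (Z (suc d + m))))
        (descend-lipschitz c d (≈-mono (m≤m+n d m) (Z-≈ (d + m) (c d))))

      -- Here c is the tail of a branch of 2^ω from level m on.

      config : ℕ → (ℕ → Bool) → Seq
      config m c = limit (approximant m c)

      config-≈ : ∀ m c d → approximant m c d ≈[ d ] config m c
      config-≈ m c = limit-≈ (approximant-≈ m c)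

      config-cong : ∀ m {c c′} → c ≗ c′ → config m c ≗ config m c′
      config-cong m e i = cong (λ z → z i) (descend-cong e (suc i) (Z (suc i + m)))

      -- Descending along `b ◂ c` from `Z (suc (suc i) + m)` to level `m` passes through an
      -- approximant of `config (suc m) c` at level `suc m`.
      config-branch : ∀ m b c → config m (b ◂ c) ≗ branch b (config (suc m) c)
      config-branch m b c i = trans
        (sym (config-≈ m (b ◂ c) (suc (suc i)) i (m≤n⇒m≤1+n ≤-refl)))
        (subst (λ k → branch b (descend c (suc i) (Z k)) i ≡ branch b (config (suc m) c) i)
          (+-suc (suc i) m)
          (branch-lipschitz b (config-≈ (suc m) c (suc i)) i ≤-refl))

      config-point : ∀ m {n} (t : Vec Bool n) c → config m (t ⌢ c) ≗ point t (config (n + m) c)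
      config-point m [] c i = refl
      config-point m {suc n} (b ∷ t) c i = trans (config-branch m b (t ⌢ c) i)
        (Lipschitz⇒cong (branch-lipschitz b)
          (λ j → trans (config-point (suc m) t c j)
            (cong (λ k → point t (config k c) j) (+-suc n m))) i)

      -- Every approximant is valid at level `suc n`, so its top edge is certified, and the
      -- certificate passes to the limit.
      config-edge : ∀ n c → config (suc n) c ∈ Edge n
      config-edge n c = edge-closed n {config (suc n) c} λ d →
        approximant (suc n) c d , ≈-sym (config-≈ (suc n) c d)
        , proj₂ (proj₂ (valid-descend F∞ c d (suc n) {Z (d + suc n)} (Z-valid (d + suc n))))

      φ : (ℕ → Bool) → Seq
      φ = config 0

      -- The prefix `s n` leads from level 0 up to level `n`, and the next bit picks a half of one
      -- configuration of level `suc n`, whose top edge joins the vertices at `s n`.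
      φ-edge : ∀ n c → R n (φ (s n ⌢ false ◂ c)) (φ (s n ⌢ true ◂ c))
      φ-edge n c = R-resp n (sym ∘ φ-end false) (sym ∘ φ-end true)
        (edge-sound n {config (suc n) c} (config-edge n c))
        where
        φ-end : ∀ b → φ (s n ⌢ b ◂ c) ≗ point (s n) (branch b (config (suc n) c))
        φ-end b i = trans (config-point 0 (s n) (b ◂ c) i)
          (trans (cong (λ k → point (s n) (config k (b ◂ c)) i) (+-identityʳ n))
            (Lipschitz⇒cong (point-lipschitz (s n)) (config-branch n b c) i))

    dichotomy :
      (∃[ F ] (∀ x → ∃[ k ] x ∈ member F k)) ⊎
      (∃[ φ ] (∀ {c c′} → c ≗ c′ → φ c ≗ φ c′) ×
              (∀ n c → R n (φ (s n ⌢ false ◂ c)) (φ (s n ⌢ true ◂ c))))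
    dichotomy with em _ {∃[ z ] z ∈ Avoids F∞}
    ... | yes (z , v) = inj₂ (φ , config-cong 0 , φ-edge)
      where open Homomorphism z v
    ... | no  none    = inj₁ (F∞ , λ x → by-contradiction λ uncovered →
                          none (x , λ k x∈ → uncovered (k , x∈)))

-- From the relations back to the graph and the action

module Equivariant (em : ∀ ℓ → ExcludedMiddle ℓ)
  (Γ : Group 0ℓ 0ℓ) (γ : ℕ → Group.Carrier Γ) (s : ∀ n → Vec Bool n)
  (G : Graph (Space.points 𝒩)) (G-borel : BorelGraph 𝒩 G)
  (a : Action Γ (Space.points 𝒩)) (a-borel : BorelAction Γ 𝒩 a)
  where

  open Classical em
  open Graph G
  open Action a
  private module Γ = Group Γ

  ~-transport : ∀ {x x′ y y′} → x ≗ x′ → y ≗ y′ → x ~ y → x′ ~ y′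
  ~-transport e e′ r = proj₂ ~-resp e (proj₁ ~-resp e′ r)

  section-borel : ∀ g → BorelMap 𝒩 (discrete Γ.setoid ⊗ 𝒩) (g ,_)
  section-borel g = preimage-borel {Y = discrete Γ.setoid ⊗ 𝒩} λ {W} o →
    open-set (lift λ {x} gx∈W →
      let _ , _ , _ , lift oV , g∈U , x∈V , UV⊆W = o {g} {x} gx∈W
          n , nbhd = oV x∈V
      in n , λ y e → UV⊆W (g∈U , nbhd y e))

  translation-borel : ∀ g → BorelMap 𝒩 𝒩 (g ·_)
  translation-borel g b = section-borel g (a-borel b)

  open Dichotomy (λ n x y → γ n · x ~ γ n · y)
    (λ n e e′ → ~-transport (·-cong Γ.refl e) (·-cong Γ.refl e′))
    (λ n → rectangle-borel
      (λ b → continuous left-lipschitz (translation-borel (γ n) b))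
      (λ b → continuous right-lipschitz (translation-borel (γ n) b)) G-borel)
    s

  -- A point gets the first member containing it, with the group element of that member's index.
  -- Shifted points of one color come from a single member, whose independence forbids an edge
  -- between them.
  coloring : ∀ F → (∀ x → ∃[ k ] x ∈ Family.member F k) → BorelColoring Γ 𝒩 G a
  coloring F cover =
      record
        { to   = color ∘ first
        ; cong = λ e → first-cong e , Γ.reflexive (cong (γ ∘ index) (first-cong e))
        }
    , (λ {P} _ → first-borel (λ k → color k ∈ P))
    , λ { n (x , g , (refl , γ≈g) , y≗gx) (x′ , g′ , (first≡n , γ≈g′) , y′≗g′x′) y~y′ →
          independent (first x) (first-∈ x)
            (subst (λ k → x′ ∈ member k) first≡n (first-∈ x′))
            (~-transport
              (λ i → trans (y≗gx i) (·-cong (Γ.sym γ≈g) (λ _ → refl) i))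
              (λ i → trans (y′≗g′x′ i) (·-cong (Γ.trans (Γ.sym γ≈g′)
                (Γ.reflexive (cong (γ ∘ index) first≡n))) (λ _ → refl) i))
              y~y′) }
    where
    open Family F
    open FirstMember borel cover

    color : ℕ → ℕ × Γ.Carrier
    color k = k , γ (index k)

  -- Both ends of an edge of stage `n` lie over `γ n`, where adjacency of the images is the `n`-th
  -- pulled-back relation.
  homomorphism : (φ : (ℕ → Bool) → Seq) → (∀ {c c′} → c ≗ c′ → φ c ≗ φ c′) →
    (∀ n c → γ n · φ (s n ⌢ false ◂ c) ~ γ n · φ (s n ⌢ true ◂ c)) →
    EquivariantHom Γ (graph-Γ Γ γ s) (action-Γ Γ) G a
  homomorphism φ φ-cong φ-edge = record
    { map = record
      { to   = λ (g , c) → g · φ c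
      ; cong = λ (e , e′) → ·-cong e (φ-cong e′)
      }
    ; equivariant  = λ h (g , c) → ·-∙ h g (φ c)
    ; homomorphism = λ
      { (n , z , inj₁ ((e , f) , (e′ , f′))) → edge n z e f e′ f′
      ; (n , z , inj₂ ((e , f) , (e′ , f′))) → ~-sym (edge n z e′ f′ e f)
      }
    }
    where
    edge : ∀ n z {g c g′ c′} →
      g Γ.≈ γ n → c ≗ s n ⌢ false ◂ z → g′ Γ.≈ γ n → c′ ≗ s n ⌢ true ◂ z →
      g · φ c ~ g′ · φ c′
    edge n z e f e′ f′ = ~-transport
      (·-cong (Γ.sym e) (φ-cong (sym ∘ f))) (·-cong (Γ.sym e′) (φ-cong (sym ∘ f′)))
      (φ-edge n z)

  coloring-or-homomorphism :
    BorelColoring Γ 𝒩 G a ⊎ EquivariantHom Γ (graph-Γ Γ γ s) (action-Γ Γ) G a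
  coloring-or-homomorphism with dichotomy
  ... | inj₁ (F , cover)           = inj₁ (coloring F cover)
  ... | inj₂ (φ , φ-cong , φ-edge) = inj₂ (homomorphism φ φ-cong φ-edge)

theorem5p2 : (∀ ℓ → ExcludedMiddle ℓ) →
    (Γ : Group 0ℓ 0ℓ) → Countable Γ →
    (γ : ℕ → Group.Carrier Γ) (s : ∀ n → Vec Bool n) → Generic Γ γ s →
    (G : Graph (Space.points 𝒩)) → BorelGraph 𝒩 G →
    (a : Action Γ (Space.points 𝒩)) → BorelAction Γ 𝒩 a →
    BorelColoring Γ 𝒩 G a ⊎ EquivariantHom Γ (graph-Γ Γ γ s) (action-Γ Γ) G a
theorem5p2 em Γ _ γ s _ = Equivariant.coloring-or-homomorphism em Γ γ s
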